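{- Let $k\ge 2$ and $n\ge 1$ be integers, $E=\{0,\dots,k-1\}$, and let $L_n\subseteq E^n$ and $\varphi:L_n\to E^{n-1}$ be as defined in the context. Then $\varphi$ is a bijection, and for every $A\subseteq L_n$, $A$ is an intersecting antichain in $E^n$ if and only if $\varphi(A)$ is an intersecting antichain in $E^{n-1}$ (equivalently, both $\varphi$ and $\varphi^{ -1}$ map intersecting antichains to intersecting antichains).
   Context: For $\mathbf a=(a_1,\dots,a_m),\mathbf b=(b_1,\dots,b_m)\in E^m$ write $\mathbf a\preceq\mathbf b$ if $a_i\le b_i$ for all $i$. A set $A\subseteq E^m$ is an antichain if there are no distinct $\mathbf a,\mathbf b\in A$ with $\mathbf a\preceq\mathbf b$. A set $A\subseteq E^m$ is intersecting if for all $\mathbf a,\mathbf b\in A$ (including $\mathbf a=\mathbf b$) there is $i$ with $a_i+b_i\ge k$. The weight is $w(\mathbf a)=a_1+\dots+a_m$, and $\mathcal B_t=\{\mathbf a\in E^n: w(\mathbf a)=t\}$. Let $g=\lfloor n(k-1)/2\rfloor$ and $C_i=\{\mathbf a\in E^n: a_1=i\}$. Define $L_n=(\mathcal B_0\cup\dots\cup\mathcal B_g)\cap(C_0\cup C_{k-1})$ if $n(k-1)$ is odd, and $L_n=((\mathcal B_0\cup\dots\cup\mathcal B_{g-1})\cap(C_0\cup C_{k-1}))\cup(\mathcal B_g\cap C_0)$ if $n(k-1)$ is even. For $a\in E$ let $\overline a=k-1-a$. Define $\varphi(a_1,\dots,a_n)=(a_2,\dots,a_n)$ if $a_1=0$,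 and $\varphi(a_1,\dots,a_n)=(\overline{a}_2,\dots,\overline{a}_n)$ if $a_1=k-1$. -}

module Defs where

open import Level using (Level; 0ℓ)
open import Data.Empty using (⊥-elim-irr)
open import Data.Fin.Base as Fin using (Fin; toℕ; opposite)
open import Data.Irrelevant using ([_])
open import Data.Nat.Base using (ℕ; suc; _+_; _*_; _∸_; _/_; _≤_; _<_)
open import Data.Nat.Divisibility using (_∣_; _∤_)
open import Data.Nat.Properties using (_≟_)
open import Data.Product.Base using (∃; _×_; _,_)
open import Data.Refinement.Base using (Refinement-syntax; value; _,_)
open import Data.Sum.Base using (_⊎_; inj₁; inj₂)
open import Data.Vec.Base using (Vec; head; tail; lookup; map; sum)
open import Relation.Binary.PropositionalEquality using (_≡_; _≢_)
open import Relation.Nullary using (¬_; yes; no)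
open import Relation.Unary using (Pred; _∈_; _⊆_; _∪_; _∩_)

private
  variable
    ℓ : Level
    k m : ℕ

-- E^m for E = {0, …, k-1}
E^ : ℕ → ℕ → Set
E^ k m = Vec (Fin k) m

_⪯_ : E^ k m → E^ k m → Set
a ⪯ b = ∀ i → lookup a i Fin.≤ lookup b i

Antichain : Pred (E^ k m) ℓ → Set ℓ
Antichain A = ∀ {a b} → a ∈ A → b ∈ A → a ≢ b → ¬ (a ⪯ b)

-- The case a = b is deliberately included.
Intersecting : Pred (E^ k m) ℓ → Set ℓ
Intersecting {k = k} A =
  ∀ {a b} → a ∈ A → b ∈ A → ∃ λ i → k ≤ toℕ (lookup a i) + toℕ (lookup b i)

IntersectingAntichain : Pred (E^ k m) ℓ → Set ℓ
IntersectingAntichain A = Intersecting A × Antichain A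

weight : E^ k m → ℕ
weight a = sum (map toℕ a)

B : ℕ → Pred (E^ k m) 0ℓ
B t a = weight a ≡ t

-- B 0 ∪ … ∪ B (s - 1)
⋃B< : ℕ → Pred (E^ k m) 0ℓ
⋃B< s a = ∃ λ t → t < s × a ∈ B t

C : ℕ → Pred (E^ k (suc m)) 0ℓ
C i a = toℕ (head a) ≡ i

g : ℕ → ℕ → ℕ
g k n = (n * (k ∸ 1)) / 2

-- L_n is L k m with n = suc m.
L-odd L-even : (k m : ℕ) → Pred (E^ k (suc m)) 0ℓ
L-odd  k m = ⋃B< (suc (g k (suc m))) ∩ (C 0 ∪ C (k ∸ 1))
L-even k m = (⋃B< (g k (suc m)) ∩ (C 0 ∪ C (k ∸ 1)))
             ∪ (B (g k (suc m)) ∩ C 0)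

L : (k m : ℕ) → Pred (E^ k (suc m)) 0ℓ
L k m a = (2 ∤ suc m * (k ∸ 1) × a ∈ L-odd k m)
        ⊎ (2 ∣ suc m * (k ∸ 1) × a ∈ L-even k m)

L⊆C₀∪Cₖ₋₁ : ∀ k m → L k m ⊆ C 0 ∪ C (k ∸ 1)
L⊆C₀∪Cₖ₋₁ k m (inj₁ (_ , _ , a∈C))         = a∈C
L⊆C₀∪Cₖ₋₁ k m (inj₂ (_ , inj₁ (_ , a∈C)))  = a∈C
L⊆C₀∪Cₖ₋₁ k m (inj₂ (_ , inj₂ (_ , a∈C₀))) = inj₁ a∈C₀

-- L_n as a type: the membership proof is irrelevant, so that elements are
-- equal exactly when the underlying tuples are.
⟨L⟩ : ℕ → ℕ → Set
⟨L⟩ k m = [ a ∈ E^ k (suc m) ∣ a ∈ L k m ]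

-- opposite x is k - 1 - x.
φ : ∀ {k m} → ⟨L⟩ k m → E^ k m
φ {k} {m} (a , [ a∈L ]) with toℕ (head a) ≟ 0 | toℕ (head a) ≟ k ∸ 1
... | yes _    | _         = tail a
... | no _     | yes _     = map opposite (tail a)
... | no a₁≢0 | no a₁≢k-1 = ⊥-elim-irr (excluded (L⊆C₀∪Cₖ₋₁ k m {a} a∈L))
  where
  excluded : ¬ (a ∈ C 0 ∪ C (k ∸ 1))
  excluded (inj₁ a₁≡0)   = a₁≢0 a₁≡0
  excluded (inj₂ a₁≡k-1) = a₁≢k-1 a₁≡k-1

φ[_] : Pred (E^ k (suc m)) ℓ → Pred (E^ k m) ℓ
φ[_] {k} {m} A c = ∃ λ (a : ⟨L⟩ k m) → value a ∈ A × φ a ≡ c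

{-# OPTIONS --safe #-}

-- Write c̄ for map opposite c, and 0c for zero ∷ c. Every element of L n is
-- 0c or the complement of 0c, where c is its image under φ; the first happens
-- exactly when 2 w(c) ≤ n (k - 1), so φ is a bijection. Two tuples a, b meet
-- (aᵢ + bᵢ ≥ k for some i) iff not a ⪯ b̄. Hence complementing both tuples of
-- a pair reverses ⪯, complementing one exchanges the intersection and the
-- antichain conditions, and the conditions that do not correspond in this way
-- hold automatically by comparing weights with n (k - 1) / 2.
module Submission where

open import Defs
open import Level using (Level)
open import Data.Empty using (⊥-elim-irr)
open import Data.Fin.Base as Fin using (Fin; zero; suc; toℕ; opposite)
open import Data.Fin.Properties
  using (toℕ-injective; toℕ-fromℕ; toℕ<n; opposite-prop; opposite-involutive; any?)
open import Data.Irrelevant using ([_])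
open import Data.Nat.Base
  using (ℕ; suc; _+_; _*_; _∸_; _/_; _≤_; _<_; z≤n; s≤s; s≤s⁻¹)
open import Data.Nat.Divisibility using (_∣_; _∤_; _∣?_; divides-refl)
open import Data.Nat.DivMod using (m/n*n≤m; m*n/n≡m; m/n*n≡m; /-monoˡ-≤)
open import Data.Nat.Properties
open import Algebra.Properties.CommutativeSemigroup +-commutativeSemigroup
  using (interchange)
open import Data.Product.Base using (∃; _×_; _,_; proj₁; proj₂; swap)
open import Data.Refinement.Base using (value; _,_)
open import Data.Refinement.Properties using (value-injective)
open import Data.Sum.Base using (_⊎_; inj₁; inj₂)
open import Data.Vec.Base using ([]; _∷_; head; lookup; map)
open import Data.Vec.Properties
  using (lookup-map; map-∘; map-cong; map-id; ∷-injectiveʳ)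
open import Function.Base using (_∘_)
open import Function.Bundles using (_⇔_; mk⇔; Equivalence)
open import Function.Consequences.Propositional
  using (strictlySurjective⇒surjective)
open import Function.Definitions using (Bijective)
open import Relation.Binary.PropositionalEquality
  using (_≡_; _≢_; refl; sym; trans; cong; cong₂; subst; subst₂)
open import Relation.Nullary using (¬_; Dec; yes; no; contradiction)
open import Relation.Nullary.Decidable using (recompute; decidable-stable)
open import Relation.Unary using (Pred; _∈_; _⊆_)

private
  variable
    ℓ : Level
    j k m : ℕ

-- Doubling and halving inequalities.

n*2≡n+n : ∀ n → n * 2 ≡ n + n
n*2≡n+n n = trans (*-comm n 2) (cong (n +_) (+-identityʳ n))

-- Both inequalities say `b < a`. With `a + b` equal to `n (k - 1)`, this carries a weight bound
-- across the half when a tuple is complemented.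
double-<-sum⇒sum-<-double : ∀ a b → b * 2 < a + b → a + b < a * 2
double-<-sum⇒sum-<-double a b lt rewrite n*2≡n+n a | n*2≡n+n b =
  +-monoʳ-< a (+-cancelʳ-< b b a lt)

sum-<-double⇒double-<-sum : ∀ a b → a + b < a * 2 → b * 2 < a + b
sum-<-double⇒double-<-sum a b lt rewrite n*2≡n+n a | n*2≡n+n b =
  +-monoˡ-< b (+-cancelˡ-< a b a lt)

≤half⇒double≤ : ∀ {w t} → w ≤ t / 2 → w * 2 ≤ t
≤half⇒double≤ {t = t} w≤ = ≤-trans (*-monoˡ-≤ 2 w≤) (m/n*n≤m t 2)

double≤⇒≤half : ∀ {w t} → w * 2 ≤ t → w ≤ t / 2
double≤⇒≤half {w} {t} le = subst (_≤ t / 2) (m*n/n≡m w 2) (/-monoˡ-≤ 2 le)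

<half⇒double< : ∀ {w t} → 2 ∣ t → w < t / 2 → w * 2 < t
<half⇒double< {w} 2∣t w< = subst (w * 2 <_) (m/n*n≡m 2∣t) (*-monoˡ-< 2 w<)

-- Evenness makes the halving exact; at `t = 1`, `w = 0` the floor would lose the strictness.
double<⇒<half : ∀ {w t} → 2 ∣ t → w * 2 < t → w < t / 2
double<⇒<half {w} {t} 2∣t lt =
  *-cancelʳ-< 2 w (t / 2) (subst (w * 2 <_) (sym (m/n*n≡m 2∣t)) lt)

-- An odd `t` is not a double, which is why `L-odd` has no exceptional middle layer.
double≤odd⇒double< : ∀ {w t} → 2 ∤ t → w * 2 ≤ t → w * 2 < t
double≤odd⇒double< {w} 2∤t le = ≤∧≢⇒< le λ { refl → 2∤t (divides-refl w) }

-- Complements and weights.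

toℕ-opposite : (x : Fin k) → toℕ x + toℕ (opposite x) ≡ k ∸ 1
toℕ-opposite {suc k} x =
  trans (cong (toℕ x +_) (opposite-prop x)) (m+[n∸m]≡n (s≤s⁻¹ (toℕ<n x)))

infix 30 ~_

~_ : E^ k m → E^ k m
~_ = map opposite

~-involutive : (a : E^ k m) → ~ ~ a ≡ a
~-involutive a =
  trans (sym (map-∘ opposite opposite a))
        (trans (map-cong opposite-involutive a) (map-id a))

~-injective : {a b : E^ k m} → ~ a ≡ ~ b → a ≡ b
~-injective {a = a} {b} eq =
  trans (sym (~-involutive a)) (trans (cong ~_ eq) (~-involutive b))

weight-~ : (a : E^ k m) → weight a + weight (~ a) ≡ m * (k ∸ 1)
weight-~ []      = refl
weight-~ (x ∷ a) =
  trans (interchange (toℕ x) (weight a) (toℕ (opposite x)) (weight (~ a)))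
        (cong₂ _+_ (toℕ-opposite x) (weight-~ a))

weight-mono : (a b : E^ k m) → a ⪯ b → weight a ≤ weight b
weight-mono []      []      _   = z≤n
weight-mono (_ ∷ a) (_ ∷ b) a⪯b = +-mono-≤ (a⪯b zero) (weight-mono a b (a⪯b ∘ suc))

-- Meeting tuples and the order.

Meet : E^ k m → E^ k m → Set
Meet {k} a b = ∃ λ i → k ≤ toℕ (lookup a i) + toℕ (lookup b i)

Meet? : (a b : E^ k m) → Dec (Meet a b)
Meet? {k} a b = any? λ i → k ≤? toℕ (lookup a i) + toℕ (lookup b i)

Meet-sym : (a b : E^ k m) → Meet a b → Meet b a
Meet-sym {k} a b (i , le) =
  i , subst (k ≤_) (+-comm (toℕ (lookup a i)) (toℕ (lookup b i))) le

≤opposite⇒+< : (x y : Fin k) → x Fin.≤ opposite y → toℕ x + toℕ y < k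
≤opposite⇒+< {suc k} x y le = s≤s (begin
  toℕ x + toℕ y             ≤⟨ +-monoˡ-≤ (toℕ y) le ⟩
  toℕ (opposite y) + toℕ y  ≡⟨ +-comm (toℕ (opposite y)) (toℕ y) ⟩
  toℕ y + toℕ (opposite y)  ≡⟨ toℕ-opposite y ⟩
  k                         ∎)
  where open ≤-Reasoning

+<⇒≤opposite : (x y : Fin k) → toℕ x + toℕ y < k → x Fin.≤ opposite y
+<⇒≤opposite {suc k} x y lt = +-cancelʳ-≤ (toℕ y) (toℕ x) (toℕ (opposite y)) (begin
  toℕ x + toℕ y             ≤⟨ s≤s⁻¹ lt ⟩
  k                         ≡⟨ toℕ-opposite y ⟨
  toℕ y + toℕ (opposite y)  ≡⟨ +-comm (toℕ y) (toℕ (opposite y)) ⟩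
  toℕ (opposite y) + toℕ y  ∎)
  where open ≤-Reasoning

⪯~⇒¬Meet : (a b : E^ k m) → a ⪯ ~ b → ¬ Meet a b
⪯~⇒¬Meet a b a⪯~b (i , le) = <⇒≱
  (≤opposite⇒+< (lookup a i) (lookup b i)
    (subst (lookup a i Fin.≤_) (lookup-map i opposite b) (a⪯~b i)))
  le

¬Meet⇒⪯~ : (a b : E^ k m) → ¬ Meet a b → a ⪯ ~ b
¬Meet⇒⪯~ a b ¬meet i =
  subst (lookup a i Fin.≤_) (sym (lookup-map i opposite b))
    (+<⇒≤opposite (lookup a i) (lookup b i) (≰⇒> λ le → ¬meet (i , le)))

-- Deciding `Meet` yields an actual coordinate from the mere failure of `⪯`.
¬⪯~⇒Meet : (a b : E^ k m) → ¬ (a ⪯ ~ b) → Meet a b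
¬⪯~⇒Meet a b a⋠~b = decidable-stable (Meet? a b) (a⋠~b ∘ ¬Meet⇒⪯~ a b)

⪯⇒¬Meet~ : (a b : E^ k m) → a ⪯ b → ¬ Meet a (~ b)
⪯⇒¬Meet~ a b a⪯b = ⪯~⇒¬Meet a (~ b) (subst (a ⪯_) (sym (~-involutive b)) a⪯b)

¬⪯⇒Meet~ : (a b : E^ k m) → ¬ (a ⪯ b) → Meet a (~ b)
¬⪯⇒Meet~ a b a⋠b = ¬⪯~⇒Meet a (~ b) (a⋠b ∘ subst (a ⪯_) (~-involutive b))

-- `a ⪯ b` says that `a` and `~ b` do not meet. Meeting is symmetric, and reading it with the roles
-- exchanged gives the reversed comparison.
~-anti : (a b : E^ k m) → a ⪯ b → ~ b ⪯ ~ a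
~-anti a b a⪯b = ¬Meet⇒⪯~ (~ b) a (⪯⇒¬Meet~ a b a⪯b ∘ Meet-sym (~ b) a)

~-anti⁻¹ : (a b : E^ k m) → ~ b ⪯ ~ a → a ⪯ b
~-anti⁻¹ a b le =
  subst₂ _⪯_ (~-involutive a) (~-involutive b) (~-anti (~ b) (~ a) le)

-- Tuples with a leading zero.

0∷-mono : (c d : E^ (suc k) m) → c ⪯ d → (zero ∷ c) ⪯ (zero ∷ d)
0∷-mono c d c⪯d zero    = z≤n
0∷-mono c d c⪯d (suc i) = c⪯d i

0∷-Meet : (c d : E^ (suc k) m) → Meet c d → Meet (zero ∷ c) (zero ∷ d)
0∷-Meet c d (i , le) = suc i , le

0∷-Meet⁻¹ : (c d : E^ (suc k) m) → Meet (zero ∷ c) (zero ∷ d) → Meet c d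
0∷-Meet⁻¹ c d (suc i , le) = i , le

-- The first coordinates are `k - 1` and 0, and the alphabet has at least two letters.
~0∷⋠0∷ : (c d : E^ (suc (suc j)) m) → ¬ (~ (zero ∷ c) ⪯ (zero ∷ d))
~0∷⋠0∷ c d le with () ← le zero

-- The graph of `φ`.

-- The graph of φ, free of the irrelevant membership proof that φ takes.
data _↦_ {k m} (a : E^ (suc k) (suc m)) (c : E^ (suc k) m) : Set where
  low  : a ≡ zero ∷ c     → weight c * 2 ≤ suc m * k → a ↦ c
  high : a ≡ ~ (zero ∷ c) → suc m * k < weight c * 2 → a ↦ c

-- The first coordinate of `a` fixes the constructor: it is 0 for `low` and `k - 1` for `high`.
↦-functional : {a : E^ (suc (suc j)) (suc m)} {c d : E^ (suc (suc j)) m} →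
               a ↦ c → a ↦ d → c ≡ d
↦-functional (low refl _)  (low eq _)  = ∷-injectiveʳ eq
↦-functional (low refl _)  (high () _)
↦-functional (high refl _) (low () _)
↦-functional (high refl _) (high eq _) = ~-injective (∷-injectiveʳ eq)

-- Here the weight of `c` fixes the constructor, and the constructor fixes the tuple.
↦-injective : {a b : E^ (suc k) (suc m)} {c : E^ (suc k) m} →
              a ↦ c → b ↦ c → a ≡ b
↦-injective (low refl _)  (low refl _)  = refl
↦-injective (low _ le)    (high _ lt)   = contradiction le (<⇒≱ lt)
↦-injective (high _ lt)   (low _ le)    = contradiction le (<⇒≱ lt)
↦-injective (high refl _) (high refl _) = refl

↦-surjective : (c : E^ (suc k) m) → ∃ λ a → a ↦ c
↦-surjective {k} {m} c with ≤-<-connex (weight c * 2) (suc m * k)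
... | inj₁ le = zero ∷ c , low refl le
... | inj₂ lt = ~ (zero ∷ c) , high refl lt

-- Membership in `L` through weights.

L⇒double≤ : (a : E^ (suc k) (suc m)) → a ∈ L (suc k) m → weight a * 2 ≤ suc m * k
L⇒double≤ a (inj₁ (_ , (_ , lt , refl) , _))        = ≤half⇒double≤ (s≤s⁻¹ lt)
L⇒double≤ a (inj₂ (_ , inj₁ ((_ , lt , refl) , _))) = ≤half⇒double≤ (<⇒≤ lt)
L⇒double≤ a (inj₂ (_ , inj₂ (eq , _)))              = ≤half⇒double≤ (≤-reflexive eq)

-- Equality is excluded by parity in the odd case; in the even case the layer of weight `g` is kept
-- only inside `C 0`.
L∖C₀⇒double< : (a : E^ (suc k) (suc m)) → a ∈ L (suc k) m → toℕ (head a) ≢ 0 →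
               weight a * 2 < suc m * k
L∖C₀⇒double< a a∈L@(inj₁ (2∤t , _)) _ =
  double≤odd⇒double< {weight a} 2∤t (L⇒double≤ a a∈L)
L∖C₀⇒double< a (inj₂ (2∣t , inj₁ ((_ , lt , refl) , _))) _ = <half⇒double< 2∣t lt
L∖C₀⇒double< a (inj₂ (_ , inj₂ (_ , a₁≡0))) a₁≢0 = contradiction a₁≡0 a₁≢0

double≤⇒L : (a : E^ (suc k) (suc m)) → weight a * 2 ≤ suc m * k → a ∈ C 0 →
            a ∈ L (suc k) m
double≤⇒L {k} {m} a le a∈C₀ with 2 ∣? suc m * k
... | no 2∤t = inj₁ (2∤t , (weight a , s≤s (double≤⇒≤half le) , refl) , inj₁ a∈C₀)
... | yes 2∣t with m≤n⇒m<n∨m≡n (double≤⇒≤half {weight a} le)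
...   | inj₁ lt = inj₂ (2∣t , inj₁ ((weight a , lt , refl) , inj₁ a∈C₀))
...   | inj₂ eq = inj₂ (2∣t , inj₂ (eq , a∈C₀))

double<⇒L : (a : E^ (suc k) (suc m)) → weight a * 2 < suc m * k → a ∈ C k →
            a ∈ L (suc k) m
double<⇒L {k} {m} a lt a∈Cₖ with 2 ∣? suc m * k
... | no 2∤t = inj₁ (2∤t , (weight a , s≤s (double≤⇒≤half (<⇒≤ lt)) , refl) , inj₂ a∈Cₖ)
... | yes 2∣t = inj₂ (2∣t , inj₁ ((weight a , double<⇒<half 2∣t lt , refl) , inj₂ a∈Cₖ))

↦⇒L : {a : E^ (suc k) (suc m)} {c : E^ (suc k) m} → a ↦ c → a ∈ L (suc k) m
↦⇒L {c = c} (low refl le) = double≤⇒L (zero ∷ c) le refl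
↦⇒L {k} {m} {c = c} (high refl lt) = double<⇒L (~ (zero ∷ c))
  (subst (weight (~ (zero ∷ c)) * 2 <_) w-sum
    -- A tuple and its complement have weights adding up to `suc m * k`, so a heavy `c` has a light
    -- complement.
    (sum-<-double⇒double-<-sum (weight c) _ (subst (_< weight c * 2) (sym w-sum) lt)))
  (toℕ-fromℕ k)
  where
  w-sum : weight c + weight (~ (zero ∷ c)) ≡ suc m * k
  w-sum = weight-~ (zero ∷ c)

last∷-↦ : (x : Fin (suc k)) (v : E^ (suc k) m) → toℕ x ≡ k →
          weight (x ∷ v) * 2 < suc m * k → (x ∷ v) ↦ (~ v)
last∷-↦ {k} {m} x v x≡k lt = high a≡
  (subst (_< weight (~ v) * 2) w-sum
    (double-<-sum⇒sum-<-double (weight (~ v)) _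
      (subst (weight (x ∷ v) * 2 <_) (sym w-sum) lt)))
  where
  a≡ : x ∷ v ≡ ~ (zero ∷ ~ v)
  a≡ = cong₂ _∷_ (toℕ-injective (trans x≡k (sym (toℕ-fromℕ k)))) (sym (~-involutive v))
  w-sum : weight (~ v) + weight (x ∷ v) ≡ suc m * k
  w-sum = trans (cong (λ a → weight (~ v) + weight a) a≡) (weight-~ (zero ∷ ~ v))

-- Bijectivity of `φ`.

φ-↦ : (a : ⟨L⟩ (suc (suc j)) m) → value a ↦ φ a
φ-↦ (zero ∷ c , [ a∈L ]) =
  -- The membership proof is irrelevant, but the inequality drawn from it is decidable and can be
  -- recomputed.
  low refl (recompute (_ ≤? _) (L⇒double≤ (zero ∷ c) a∈L))
φ-↦ {j} (suc x ∷ c , [ a∈L ]) with toℕ (suc x) ≟ suc j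
... | yes eq = last∷-↦ (suc x) c eq
                 (recompute (_ <? _) (L∖C₀⇒double< (suc x ∷ c) a∈L λ ()))
... | no neq = ⊥-elim-irr (excluded (L⊆C₀∪Cₖ₋₁ _ _ {suc x ∷ c} a∈L))
  where
  excluded : ¬ (toℕ (suc x) ≡ 0 ⊎ toℕ (suc x) ≡ suc j)
  excluded (inj₂ eq) = neq eq

φ-bijective : Bijective _≡_ _≡_ (φ {suc (suc j)} {m})
φ-bijective =
  (λ {a} {b} eq → value-injective
    (↦-injective (φ-↦ a) (subst (value b ↦_) (sym eq) (φ-↦ b)))) ,
  strictlySurjective⇒surjective λ c →
    let (a , a↦c) = ↦-surjective c
        a′        = a , [ ↦⇒L a↦c ]
    in a′ , ↦-functional (φ-↦ a′) a↦c

-- Compatibility of pairs.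

-- Both order conditions, since complementing a and b swaps them.
Compatible : E^ k m → E^ k m → Set
Compatible a b = Meet a b × (a ≢ b → ¬ (a ⪯ b) × ¬ (b ⪯ a))

Compatible-sym : (a b : E^ k m) → Compatible a b → Compatible b a
Compatible-sym a b (meet , anti) =
  Meet-sym a b meet , λ b≢a → swap (anti (b≢a ∘ sym))

module _ (A : Pred (E^ k m) ℓ) where

  compatible⇒IA : (∀ {a b} → a ∈ A → b ∈ A → Compatible a b) → IntersectingAntichain A
  compatible⇒IA h =
    (λ a∈A b∈A → proj₁ (h a∈A b∈A)) ,
    (λ a∈A b∈A a≢b → proj₁ (proj₂ (h a∈A b∈A) a≢b))

  IA⇒compatible : IntersectingAntichain A → ∀ {a b} → a ∈ A → b ∈ A → Compatible a b
  IA⇒compatible (int , anti) a∈A b∈A =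
    int a∈A b∈A , λ a≢b → anti a∈A b∈A a≢b , anti b∈A a∈A (a≢b ∘ sym)

-- c ⪯ d̄ would force w(c) + w(d) ≤ m k, but w(c) + w(d) > (m + 1) k.
heavy⇒Meet : (c d : E^ (suc k) m) → suc m * k < weight c * 2 →
             suc m * k < weight d * 2 → Meet c d
heavy⇒Meet {k} {m} c d c-heavy d-heavy = ¬⪯~⇒Meet c d λ c⪯~d →
  <⇒≱ 2t<2sum (subst ((weight c + weight d) * 2 ≤_) (n*2≡n+n t) (*-monoˡ-≤ 2 (sum≤t c⪯~d)))
  where
  open ≤-Reasoning
  t : ℕ
  t = suc m * k
  sum≤t : c ⪯ ~ d → weight c + weight d ≤ t
  sum≤t c⪯~d = begin
    weight c + weight d      ≤⟨ +-monoˡ-≤ (weight d) (weight-mono c (~ d) c⪯~d) ⟩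
    weight (~ d) + weight d  ≡⟨ +-comm (weight (~ d)) (weight d) ⟩
    weight d + weight (~ d)  ≡⟨ weight-~ d ⟩
    m * k                    ≤⟨ m≤n+m (m * k) k ⟩
    t                        ∎
  2t<2sum : t + t < (weight c + weight d) * 2
  2t<2sum = subst (t + t <_) (sym (*-distribʳ-+ 2 (weight c) (weight d)))
              (+-mono-< c-heavy d-heavy)

-- A common leading zero neither gives a meeting coordinate nor obstructs `⪯`.
0∷-Compatible : (c d : E^ (suc k) m) →
                Compatible (zero ∷ c) (zero ∷ d) ⇔ Compatible c d
0∷-Compatible c d = mk⇔
  (λ (meet , anti) → 0∷-Meet⁻¹ c d meet , λ c≢d →
    let (p , q) = anti (c≢d ∘ ∷-injectiveʳ) in p ∘ 0∷-mono c d , q ∘ 0∷-mono d c)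
  (λ (meet , anti) → 0∷-Meet c d meet , λ a≢b →
    let (p , q) = anti (a≢b ∘ cong (zero ∷_)) in
    (λ le → p (le ∘ suc)) , (λ le → q (le ∘ suc)))

-- The complements always meet, in their leading `k - 1`, so their compatibility says nothing on
-- whether `c` and `d` meet; that is supplied as a hypothesis.
~0∷-Compatible : (c d : E^ (suc (suc j)) m) → Meet c d →
                 Compatible (~ (zero ∷ c)) (~ (zero ∷ d)) ⇔ Compatible c d
~0∷-Compatible c d c∧d = mk⇔
  (λ (_ , anti) → c∧d , λ c≢d →
    let (p , q) = anti (c≢d ∘ ~-injective ∘ ∷-injectiveʳ) in
    q ∘ ~-anti ĉ d̂ ∘ 0∷-mono c d , p ∘ ~-anti d̂ ĉ ∘ 0∷-mono d c)
  (λ (_ , anti) → ¬⪯⇒Meet~ (~ ĉ) d̂ (~0∷⋠0∷ c d) , λ a≢b →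
    let (p , q) = anti (a≢b ∘ cong (λ v → ~ (zero ∷ v))) in
    (λ le → q (~-anti⁻¹ d̂ ĉ le ∘ suc)) , (λ le → p (~-anti⁻¹ ĉ d̂ le ∘ suc)))
  where
  ĉ = zero ∷ c
  d̂ = zero ∷ d

-- The two conditions trade places: the left pair meets iff not `c ⪯ d`, and its first tuple is not
-- below its second iff `c` and `d` meet. The opposite comparisons fail by first coordinate on the
-- left and by weight on the right.
0∷-~0∷-Compatible : (c d : E^ (suc (suc j)) m) → weight c < weight d →
                    Compatible (zero ∷ c) (~ (zero ∷ d)) ⇔ Compatible c d
0∷-~0∷-Compatible c d c<d = mk⇔
  (λ (meet , anti) →
    ¬⪯~⇒Meet c d (λ c⪯~d → proj₁ (anti λ ())
      (¬Meet⇒⪯~ ĉ d̂ (⪯~⇒¬Meet c d c⪯~d ∘ 0∷-Meet⁻¹ c d))) ,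
    λ _ → (λ c⪯d → ⪯⇒¬Meet~ ĉ d̂ (0∷-mono c d c⪯d) meet) ,
          (λ d⪯c → <⇒≱ c<d (weight-mono d c d⪯c)))
  (λ (meet , anti) →
    ¬⪯⇒Meet~ ĉ d̂ (λ le → proj₁ (anti (λ c≡d → <⇒≢ c<d (cong weight c≡d))) (le ∘ suc)) ,
    λ _ → (λ le → ⪯~⇒¬Meet ĉ d̂ le (0∷-Meet c d meet)) , ~0∷⋠0∷ d c)
  where
  ĉ = zero ∷ c
  d̂ = zero ∷ d

↦-Compatible : {a b : E^ (suc (suc j)) (suc m)} {c d : E^ (suc (suc j)) m} →
               a ↦ c → b ↦ d → Compatible a b ⇔ Compatible c d
↦-Compatible {c = c} {d} (low refl _) (low refl _) = 0∷-Compatible c d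
↦-Compatible {c = c} {d} (low refl le) (high refl lt) =
  -- The threshold `n (k - 1)` separates the two doubled weights.
  0∷-~0∷-Compatible c d (*-cancelʳ-< 2 (weight c) (weight d) (≤-<-trans le lt))
↦-Compatible {a = a} {b} {c} {d} (high refl lt) (low refl le) = mk⇔
  (Compatible-sym d c ∘ to ∘ Compatible-sym a b)
  (Compatible-sym b a ∘ from ∘ Compatible-sym c d)
  where
  open Equivalence
    (0∷-~0∷-Compatible d c (*-cancelʳ-< 2 (weight d) (weight c) (≤-<-trans le lt)))
↦-Compatible {c = c} {d} (high refl lt) (high refl lt′) =
  ~0∷-Compatible c d (heavy⇒Meet c d lt lt′)

theorem1 : (ℓ : Level) (k m : ℕ) → 2 ≤ k →
    Bijective _≡_ _≡_ (φ {k} {m}) ×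
    ((A : Pred (E^ k (suc m)) ℓ) → A ⊆ L k m →
    IntersectingAntichain A ⇔ IntersectingAntichain φ[ A ])
theorem1 ℓ (suc (suc j)) m (s≤s (s≤s z≤n)) = φ-bijective , λ A A⊆L → mk⇔
  (λ ia → compatible⇒IA φ[ A ] λ { (a , a∈A , refl) (b , b∈A , refl) →
    Equivalence.to (↦-Compatible (φ-↦ a) (φ-↦ b)) (IA⇒compatible A ia a∈A b∈A) })
  (λ ia → compatible⇒IA A λ {a} {b} a∈A b∈A →
    -- Lying in `L` lifts the tuples of `A` to the domain of `φ`, so their images belong to
    -- `φ[ A ]`.
    let a′ = a , [ A⊆L a∈A ]
        b′ = b , [ A⊆L b∈A ]
    in Equivalence.from (↦-Compatible (φ-↦ a′) (φ-↦ b′))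
         (IA⇒compatible φ[ A ] ia (a′ , a∈A , refl) (b′ , b∈A , refl)))
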